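{- Let $G=(V,E)$ be a finite graph, with multiple edges and loops allowed. For every non-loop edge $e=u_1u_2\in E$, $$A_{G}(V)=A_{G\setminus e}(V)+A_{G/e}(V/e)$$ as polynomials in $\mathbb{Z}[V]$, where in $A_{G/e}(V/e)$ the variable $v_e$ attached to the vertex of $G/e$ created by contracting $e$ is replaced by the element $v_e=1-(1-u_1)(1-u_2)=u_1+u_2-u_1u_2\in\mathbb{Z}[V]$.
   Context: Graphs are finite and may have multiple edges and loops. An orientation of $G$ assigns a direction to each edge; it is acyclic if it has no directed cycles (so a graph with a loop has no acyclic orientation). $\mathcal{A}(G)$ is the set of acyclic orientations of $G$. For $\mathfrak{o}\in\mathcal{A}(G)$, a vertex $v$ is a sink if every edge incident with $v$ is directed toward $v$ (in particular, isolated vertices are sinks); $\operatorname{Sink}(\mathfrak{o})$ is the set of sinks of $\mathfrak{o}$. To each vertex $v\in V$ associate a commuting variable, also denoted $v$, and let $\mathbb{Z}[V]$ be the polynomial ring in these variables. The acyclic orientation polynomial of $G$ is $$A_G(V)=\sum_{\mathfrak{o}\in\mathcal{A}(G)}\ \prod_{v\in\operatorname{Sink}(\mathfrak{o})}v\ \in\mathbb{Z}[V]$$ (so $A_G(V)=0$ if $G$ has a loop). $G\setminus e$ is the graph obtained from $G$ by deleting the edge $e$ (same vertex set $V$). For a non-loop edge $e=u_1u_2$, $G/e$ is the graph obtained by contracting $e$: its vertex set is $V/e=(V\setminus\{u_1,u_2\})\cup\{v_e\}$, where $v_e$ is the new vertex, and its edges are the edges of $G$ other than $e$, with endpoints $u_1,u_2$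 replaced by $v_e$; any edge of $G$ parallel to $e$ becomes a loop in $G/e$, and multiple edges are kept. -}

module Defs where

open import Data.Bool.Base using (if_then_else_)
open import Data.Fin.Base using (Fin)
open import Data.Integer.Base as ℤ using (ℤ; 0ℤ; 1ℤ)
open import Data.List.Base
  using (List; []; _∷_; _++_; _∷ʳ_; length; lookup; map; foldr; filter; zipWith;
         removeAt; deduplicate; cartesianProductWith)
open import Data.List.Membership.Propositional using (_∈_; lose)
open import Data.List.Membership.Propositional.Properties
  using (∈-map⁺; ∈-deduplicate⁺)
import Data.List.Membership.DecPropositional as DecMembership
open import Data.List.Relation.Unary.All as All using (All)
open import Data.List.Relation.Unary.All.Properties using (¬Any⇒All¬)
open import Data.List.Relation.Unary.AllPairs using ([]; _∷_)
open import Data.List.Relation.Unary.Any as Any using (any?; here; there)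
open import Data.List.Relation.Unary.Linked using (Linked; [-]; _∷_)
open import Data.List.Relation.Unary.Unique.Propositional using (Unique)
open import Data.List.Relation.Unary.Unique.DecPropositional.Properties
  using (deduplicate-!)
open import Data.Nat.Base as ℕ using (ℕ; zero; suc)
import Data.Nat.Properties as ℕ
open import Data.Product.Base
  using (∃-syntax; _×_; _,_; proj₁; proj₂; swap; map₁)
import Data.Product.Base as Product
open import Data.Sum.Base using (_⊎_; inj₁; inj₂)
open import Data.Vec.Base as Vec using (Vec)
open import Function.Base using (_∘_)
open import Function.Bundles using (_⇔_; mk⇔; Equivalence)
open import Level using (0ℓ)
open import Relation.Binary.Construct.Closure.Transitive
  using (TransClosure; [_]; _∷_)
import Relation.Binary.Construct.Closure.Transitive as TC
open import Relation.Binary.Core using (Rel)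
open import Relation.Binary.Definitions using (DecidableEquality)
open import Relation.Binary.PropositionalEquality
  using (_≡_; _≢_; refl; subst)
open import Relation.Nullary.Decidable
  using (Dec; yes; no; does; map′; ¬?; _×-dec_; _⊎-dec_; _→-dec_)
open import Relation.Nullary.Negation using (¬_; contradiction)

record FiniteSet : Set₁ where
  field
    Carrier  : Set
    _≟_      : DecidableEquality Carrier
    elements : List Carrier
    complete : ∀ x → x ∈ elements
    unique   : Unique elements

-- Poly V represents ℤ[V]: a formal sum of terms c·∏ v^(k v), in any order and possibly
-- with repeated monomials; two polynomials are equal when all their
-- coefficients agree.

record Poly (V : FiniteSet) : Set where
  constructor poly
  open FiniteSet V using (Carrier)
  field
    terms : List (ℤ × (Carrier → ℕ))

open Poly

module _ {V : FiniteSet} where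
  open FiniteSet V

  coeff : Poly V → (Carrier → ℕ) → ℤ
  coeff p m = foldr ℤ._+_ 0ℤ (map
    (λ (c , k) → if does (All.all? (λ v → k v ℕ.≟ m v) elements) then c else 0ℤ)
    (terms p))

  infix 4 _≈_
  _≈_ : Rel (Poly V) 0ℓ
  p ≈ q = ∀ m → coeff p m ≡ coeff q m

  const : ℤ → Poly V
  const c = poly ((c , λ _ → 0) ∷ [])

  var : Carrier → Poly V
  var v = poly ((1ℤ , λ w → if does (v ≟ w) then 1 else 0) ∷ [])

  0# 1# : Poly V
  0# = poly []
  1# = const 1ℤ

  infixl 6 _+_ _-_
  infixl 7 _*_
  infixr 8 _^_

  _+_ : Poly V → Poly V → Poly V
  p + q = poly (terms p ++ terms q)

  _-_ : Poly V → Poly V → Poly V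
  p - q = p + poly (map (map₁ (λ c → ℤ.- c)) (terms q))

  _*_ : Poly V → Poly V → Poly V
  p * q = poly (cartesianProductWith
    (λ (c , k) (d , l) → (c ℤ.* d) , (λ v → k v ℕ.+ l v)) (terms p) (terms q))

  _^_ : Poly V → ℕ → Poly V
  p ^ zero  = 1#
  p ^ suc n = p * p ^ n

  sum : List (Poly V) → Poly V
  sum = foldr _+_ 0#

  product : List (Poly V) → Poly V
  product = foldr _*_ 1#

-- substitute σ is the ring homomorphism ℤ[W] → ℤ[V] sending w to σ w.

substitute : ∀ {W V} → (FiniteSet.Carrier W → Poly V) → Poly W → Poly V
substitute {W} σ p =
  sum (map (λ (c , k) → const c * product (map (λ w → σ w ^ k w) elements)) (terms p))
  where open FiniteSet W using (elements)

-- An edge is listed with its two ends in an arbitrary order, which serves only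
-- as a reference direction. Edges are identified by their position in the list,
-- so repeated entries are parallel edges.

record Graph : Set₁ where
  field
    vertices : FiniteSet
  open FiniteSet vertices public using () renaming (Carrier to Vertex)
  field
    edges : List (Vertex × Vertex)

  Edge : Set
  Edge = Fin (length edges)

  end₁ end₂ : Edge → Vertex
  end₁ e = proj₁ (lookup edges e)
  end₂ e = proj₂ (lookup edges e)

  NonLoop : Edge → Set
  NonLoop e = end₁ e ≢ end₂ e

infixl 7 _∖_ _/_

_∖_ : (G : Graph) → Graph.Edge G → Graph
G ∖ e = record { vertices = vertices ; edges = removeAt edges e }
  where open Graph G

-- The set (V ∖ {u₁ , u₂}) ∪ {vₑ}.

data Merged {V : Set} (u₁ u₂ : V) : Set where
  vₑ  : Merged u₁ u₂
  old : (v : V) → v ≢ u₁ → v ≢ u₂ → Merged u₁ u₂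

module _ (V : FiniteSet) (u₁ u₂ : FiniteSet.Carrier V) where
  open FiniteSet V

  merge : Carrier → Merged u₁ u₂
  merge v with v ≟ u₁ | v ≟ u₂
  ... | no v≢u₁ | no v≢u₂ = old v v≢u₁ v≢u₂
  ... | yes _   | _       = vₑ
  ... | no _    | yes _   = vₑ

  merge-u₁ : merge u₁ ≡ vₑ
  merge-u₁ with u₁ ≟ u₁ | u₁ ≟ u₂
  ... | yes _ | _     = refl
  ... | no ¬p | _     = contradiction refl ¬p

  merge-old : ∀ v (p : v ≢ u₁) (q : v ≢ u₂) → merge v ≡ old v p q
  merge-old v p q with v ≟ u₁ | v ≟ u₂
  ... | no _   | no _   = refl
  ... | yes eq | _      = contradiction eq p
  ... | no _   | yes eq = contradiction eq q

  _≟ᴹ_ : DecidableEquality (Merged u₁ u₂)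
  vₑ        ≟ᴹ vₑ        = yes refl
  vₑ        ≟ᴹ old _ _ _ = no λ ()
  old _ _ _ ≟ᴹ vₑ        = no λ ()
  old v _ _ ≟ᴹ old w _ _ = map′ (λ { refl → refl }) (λ { refl → refl }) (v ≟ w)

  merged : FiniteSet
  merged = record
    { Carrier  = Merged u₁ u₂
    ; _≟_      = _≟ᴹ_
    ; elements = deduplicate _≟ᴹ_ (map merge elements)
    ; complete = ∈-deduplicate⁺ _≟ᴹ_ ∘ ∈-image
    ; unique   = deduplicate-! _≟ᴹ_ (map merge elements)
    }
    where
    ∈-image : ∀ x → x ∈ map merge elements
    ∈-image vₑ          = subst (_∈ map merge elements) merge-u₁ (∈-map⁺ merge (complete u₁))
    ∈-image (old v p q) = subst (_∈ map merge elements) (merge-old v p q) (∈-map⁺ merge (complete v))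

-- Edges parallel to e become loops at vₑ. Only meaningful when e is not a loop.

_/_ : (G : Graph) → Graph.Edge G → Graph
G / e = record
  { vertices = merged vertices (end₁ e) (end₂ e)
  ; edges    = map (Product.map π π) (removeAt edges e)
  }
  where
  open Graph G
  π : Vertex → Merged (end₁ e) (end₂ e)
  π = merge vertices (end₁ e) (end₂ e)

module _ {A : Set} where

  -- A cycle v → v₁ → ⋯ → vₖ → v through distinct vertices; k = 0 is a loop.
  DirectedCycle : Rel A 0ℓ → Set
  DirectedCycle R = ∃[ v ] ∃[ vs ] Unique (v ∷ vs) × Linked R (v ∷ vs ∷ʳ v)

  Arcs : List (A × A) → Rel A 0ℓ
  Arcs as x y = (x , y) ∈ as

module _ {A : Set} (_≟_ : DecidableEquality A) where
  open DecMembership _≟_ using (_∈?_)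

  private
    cut : ∀ {R : Rel A 0ℓ} {x y xs} → x ∈ xs → Unique xs → Linked R (xs ∷ʳ y) →
          ∃[ vs ] Unique (x ∷ vs) × Linked R (x ∷ vs ∷ʳ y)
    cut {xs = _ ∷ vs} (here refl) u l = vs , u , l
    cut {xs = _ ∷ _ ∷ _} (there x∈) (_ ∷ u) (_ ∷ l) = cut x∈ u l

    linked⇒closure : ∀ {R : Rel A 0ℓ} {x y} xs →
                     Linked R (x ∷ xs ∷ʳ y) → TransClosure R x y
    linked⇒closure []       (r ∷ [-]) = [ r ]
    linked⇒closure (_ ∷ xs) (r ∷ l)   = r ∷ linked⇒closure xs l

    closure⇒linked : ∀ {R : Rel A 0ℓ} {x y} → TransClosure R x y →
                     ∃[ vs ] Unique (x ∷ vs) × Linked R (x ∷ vs ∷ʳ y)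
    closure⇒linked [ r ] = [] , All.[] ∷ [] , r ∷ [-]
    closure⇒linked {x = x} (_∷_ {y = z} r rs)
      with vs , u , l ← closure⇒linked rs
      with x ∈? (z ∷ vs)
    ... | yes x∈ = cut x∈ u l
    ... | no  x∉ = z ∷ vs , ¬Any⇒All¬ _ x∉ ∷ u , r ∷ l

  cycle⇔closure : ∀ {R : Rel A 0ℓ} → DirectedCycle R ⇔ (∃[ v ] TransClosure R v v)
  cycle⇔closure = mk⇔
    (λ (v , vs , _ , l) → v , linked⇒closure vs l)
    (λ (v , rs) → v , closure⇒linked rs)

  private
    Through : A → A → List (A × A) → Rel A 0ℓ
    Through a b as x y =
      (x ≡ a ⊎ TransClosure (Arcs as) x a) × (b ≡ y ⊎ TransClosure (Arcs as) b y)

    split : ∀ {a b as} {x y : A} → TransClosure (Arcs ((a , b) ∷ as)) x y →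
            TransClosure (Arcs as) x y ⊎ Through a b as x y
    split [ here refl ] = inj₂ (inj₁ refl , inj₁ refl)
    split [ there r ]   = inj₁ [ r ]
    split (r ∷ rs) with r | split rs
    ... | here refl | inj₁ q               = inj₂ (inj₁ refl , inj₂ q)
    ... | here refl | inj₂ (_ , q)         = inj₂ (inj₁ refl , q)
    ... | there r′  | inj₁ q               = inj₁ (r′ ∷ q)
    ... | there r′  | inj₂ (inj₁ refl , q) = inj₂ (inj₂ [ r′ ] , q)
    ... | there r′  | inj₂ (inj₂ p , q)    = inj₂ (inj₂ (r′ ∷ p) , q)

    weaken : ∀ {a} {as : List (A × A)} {x y} → TransClosure (Arcs as) x y →
             TransClosure (Arcs (a ∷ as)) x y
    weaken [ r ]    = [ there r ]
    weaken (r ∷ rs) = there r ∷ weaken rs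

    join : ∀ {a b as x y} → TransClosure (Arcs as) x y ⊎ Through a b as x y →
           TransClosure (Arcs ((a , b) ∷ as)) x y
    join (inj₁ p) = weaken p
    join (inj₂ (inj₁ refl , inj₁ refl)) = [ here refl ]
    join (inj₂ (inj₁ refl , inj₂ q))    = here refl ∷ weaken q
    join (inj₂ (inj₂ p , inj₁ refl))    = weaken p TC.∷ʳ here refl
    join (inj₂ (inj₂ p , inj₂ q))    = weaken p TC.++ (here refl ∷ weaken q)

  closure? : ∀ as x y → Dec (TransClosure (Arcs as) x y)
  closure? [] x y = no λ { [ () ] ; (() ∷ _) }
  closure? ((a , b) ∷ as) x y = map′ join split
    (closure? as x y ⊎-dec
      ((x ≟ a ⊎-dec closure? as x a) ×-dec (b ≟ y ⊎-dec closure? as b y)))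

data Direction : Set where
  forward backward : Direction

direct : ∀ {A : Set} → A × A → Direction → A × A
direct a forward  = a
direct a backward = swap a

allDirections : ∀ n → List (Vec Direction n)
allDirections zero    = Vec.[] ∷ []
allDirections (suc n) =
  cartesianProductWith Vec._∷_ (forward ∷ backward ∷ []) (allDirections n)

module _ (G : Graph) where
  open Graph G
  open FiniteSet vertices using (_≟_; elements; complete)

  Orientation : Set
  Orientation = Vec Direction (length edges)

  -- The directed edges (tail , head).
  arcs : Orientation → List (Vertex × Vertex)
  arcs o = zipWith direct edges (Vec.toList o)

  Acyclic : Orientation → Set
  Acyclic o = ¬ DirectedCycle (Arcs (arcs o))

  acyclic? : ∀ o → Dec (Acyclic o)
  acyclic? o = ¬? (map′
    (λ a → from (Any.satisfied a))
    (λ c → let v , p = to c in lose (complete v) p)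
    (any? (λ v → closure? _≟_ (arcs o) v v) elements))
    where open Equivalence (cycle⇔closure _≟_ {Arcs (arcs o)})

  IsSink : Orientation → Vertex → Set
  IsSink o v = All (λ (t , h) → t ≡ v ⊎ h ≡ v → h ≡ v) (arcs o)

  isSink? : ∀ o v → Dec (IsSink o v)
  isSink? o v =
    All.all? (λ (t , h) → (t ≟ v ⊎-dec h ≟ v) →-dec h ≟ v) (arcs o)

  A : Poly vertices
  A = sum (map (λ o → product (map var (filter (isSink? o) elements)))
               (filter acyclic? (allDirections (length edges))))

  uncontract : (e : Edge) → Graph.Vertex (G / e) → Poly vertices
  uncontract e vₑ          = 1# - (1# - var (end₁ e)) * (1# - var (end₂ e))
  uncontract e (old v _ _) = var v

{-# OPTIONS --safe #-}
module Submission where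

open import Defs

open import Algebra.Bundles using (CommutativeRing; CommutativeMonoid)
import Algebra.Properties.AbelianGroup as AbelianGroupProperties
import Algebra.Properties.CommutativeSemigroup as CommutativeSemigroupProperties
import Algebra.Solver.Ring as RingSolver
open import Algebra.Solver.Ring.AlmostCommutativeRing
  using (fromCommutativeRing; _-Raw-AlmostCommutative⟶_)
open import Data.Bool.Base using (if_then_else_; true; false)
open import Data.Fin.Base using (Fin; zero; suc)
open import Data.Integer.Base as ℤ using (ℤ; 0ℤ; 1ℤ)
import Data.Integer.Properties as ℤ
open import Data.Integer.Solver using (module +-*-Solver)
open import Data.List.Base
  using (List; []; _∷_; _++_; map; foldr; filter; length; lookup; removeAt; zipWith)
open import Data.List.Membership.Propositional using (_∈_; _∉_; lose)
open import Data.List.Membership.Propositional.Properties using (∈-map⁺; ∈-map⁻; ∈-filter⁺)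
open import Data.List.Membership.Propositional.Properties.WithK using (unique∧set⇒bag)
open import Data.List.Properties using (map-++; map-∘; ++-identityʳ; filter-≐)
open import Data.List.Relation.Binary.BagAndSetEquality using (∼bag⇒↭)
open import Data.List.Relation.Binary.Permutation.Propositional
  using (_↭_; prep; swap; ↭-refl; ↭-sym; ↭-trans; ↭⇒↭ₛ′)
open import Data.List.Relation.Binary.Permutation.Propositional.Properties
  using (All-resp-↭; ∈-resp-↭)
import Data.List.Relation.Binary.Permutation.Propositional.Properties as ↭
import Data.List.Relation.Binary.Permutation.Setoid.Properties as Permutation
open import Data.List.Relation.Unary.All as All using (All; []; _∷_)
open import Data.List.Relation.Unary.All.Properties using (all-filter; map⁺; map⁻; ¬Any⇒All¬)
open import Data.List.Relation.Unary.AllPairs using (_∷_)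
open import Data.List.Relation.Unary.Any as Any using (any?; here; there)
open import Data.List.Relation.Unary.Unique.Propositional using (Unique)
import Data.List.Relation.Unary.Unique.Propositional.Properties as Unique
open import Data.Maybe.Base as Maybe using (Maybe)
open import Data.Nat.Base as ℕ using (ℕ; zero; suc)
import Data.Nat.Properties as ℕ
open import Data.Product.Base using (_×_; _,_; proj₁; proj₂; ∃-syntax; map₁)
  renaming (swap to reverse)
import Data.Product.Base as Product
open import Data.Sum.Base using (_⊎_; inj₁; inj₂; [_,_]′)
import Data.Vec.Base as Vec
open import Function.Base using (_∘_)
open import Function.Bundles using (_⇔_; mk⇔; Equivalence)
open import Level using (0ℓ)
open import Relation.Binary.Construct.Closure.Transitive using (TransClosure; [_]; _∷_)
import Relation.Binary.Construct.Closure.Transitive as TC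
open import Relation.Binary.PropositionalEquality
  using (_≡_; _≢_; _≗_; refl; sym; trans; cong; cong₂; subst; module ≡-Reasoning)
import Relation.Binary.Reasoning.Setoid as SetoidReasoning
open import Relation.Nullary.Decidable
  using (Dec; yes; no; does; does-⇔; dec-true; dec-false; decidable-stable; dec⇒maybe;
         map′; ¬?; _⊎-dec_; _→-dec_)
open import Relation.Nullary.Negation using (¬_; contradiction)
open import Relation.Unary using (Pred; Decidable)

-- Compare the contributions of each orientation o of G ∖ e. If o is cyclic, all of
-- them vanish. If o is acyclic and has a directed path between the ends of e, then
-- G / e is cyclic and exactly one of the two extensions of o to G is acyclic, with
-- the same sinks as o. Otherwise both extensions and the contraction are acyclic.
-- In that case let x, y be the factors contributed by u₁, u₂ to the weight of o (the
-- variable at a sink, 1 otherwise) and p the product of the other factors. Directing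
-- e makes its tail a nonsink, so the two extensions weigh y p + x p, while o weighs
-- y x p and its contraction (y + x - y x) p.

-- The ring of polynomials

-- The value of `vₑ` is forced by the last case. When no path joins the ends, `vₑ` is a sink of the
-- contraction exactly when both ends are sinks of o. Its factor must therefore be the new value if
-- `x` and `y` are both variables, and 1 as soon as one of them is 1; `1 - (1 - x) * (1 - y)` does
-- both, so one formula serves every pattern of sinks. The graphs compared have different edge lists
-- and two vertex types. Oriented graphs are therefore handled as bare lists of arcs, and weights
-- take values in an arbitrary commutative ring through an assignment on the vertices: `var` for `G`
-- and the deletion, `uncontract` for the contraction. The substitution is thus carried out before
-- anything is compared. The delicate point is that the contraction stays acyclic in the last case.
-- A cycle through `vₑ` may enter at one end of e and leave at the other, so it need not lift to a
-- closed walk; it has to be shown that the broken lift still contains a path between the ends.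

module PolynomialRing (V : FiniteSet) where
  open FiniteSet V
  open Poly

  Exponent : Set
  Exponent = Carrier → ℕ

  eval : (Exponent → ℤ) → List (ℤ × Exponent) → ℤ
  eval f []             = 0ℤ
  eval f ((c , k) ∷ ts) = c ℤ.* f k ℤ.+ eval f ts

  -- Exponents are functions, and laws such as commutativity of `⊞` hold only pointwise; functionals
  -- must respect this to see the two sides as equal.
  Extensional : (Exponent → ℤ) → Set
  Extensional f = ∀ {k l} → k ≗ l → f k ≡ f l

  -- Coefficients are the values of particular linear functionals, so this
  -- relation implies _≈_. Unlike _≈_ it is a congruence by a direct computation,
  -- because (p , q) ↦ eval f (p * q) is bilinear.
  infix 4 _≃_
  record _≃_ (p q : Poly V) : Set where
    constructor functionals
    field
      agree : ∀ f → Extensional f → eval f (terms p) ≡ eval f (terms q)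
  open _≃_ public

  ≃⇒≈ : ∀ {p q} → p ≃ q → p ≈ q
  ≃⇒≈ {p} {q} p≃q m = begin
    coeff p m                ≡⟨ coeff-eval (terms p) ⟩
    eval indicator (terms p) ≡⟨ agree p≃q indicator indicator-ext ⟩
    eval indicator (terms q) ≡⟨ coeff-eval (terms q) ⟨
    coeff q m                ∎
    where
    open ≡-Reasoning
    same? = λ (k : Exponent) → All.all? (λ v → k v ℕ.≟ m v) elements

    indicator : Exponent → ℤ
    indicator k = if does (same? k) then 1ℤ else 0ℤ

    indicator-ext : Extensional indicator
    indicator-ext {k} {l} k≗l = cong (if_then 1ℤ else 0ℤ) (does-⇔
      (mk⇔ (All.map (λ {v} → trans (sym (k≗l v)))) (All.map (λ {v} → trans (k≗l v))))
      (same? k) (same? l))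

    coeff-eval : ∀ ts → coeff {V} (poly ts) m ≡ eval indicator ts
    coeff-eval []             = refl
    coeff-eval ((c , k) ∷ ts) with does (same? k)
    ... | true  = cong₂ ℤ._+_ {v = eval indicator ts} (sym (ℤ.*-identityʳ c)) (coeff-eval ts)
    ... | false = cong₂ ℤ._+_ {v = eval indicator ts} (sym (ℤ.*-zeroʳ c)) (coeff-eval ts)

  eval-++ : ∀ f ts us → eval f (ts ++ us) ≡ eval f ts ℤ.+ eval f us
  eval-++ f []             us = sym (ℤ.+-identityˡ _)
  eval-++ f ((c , k) ∷ ts) us =
    trans (cong (ℤ._+_ (c ℤ.* f k)) (eval-++ f ts us)) (sym (ℤ.+-assoc (c ℤ.* f k) _ _))

  eval-neg : ∀ f ts → eval f (map (map₁ λ c → ℤ.- c) ts) ≡ ℤ.- eval f ts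
  eval-neg f []             = refl
  eval-neg f ((c , k) ∷ ts) =
    trans (cong₂ ℤ._+_ (sym (ℤ.neg-distribˡ-* c (f k))) (eval-neg f ts))
          (sym (ℤ.neg-distrib-+ (c ℤ.* f k) _))

  eval-cong : ∀ {f g} → f ≗ g → eval f ≗ eval g
  eval-cong f≗g []             = refl
  eval-cong f≗g ((c , k) ∷ ts) =
    cong₂ (λ x y → c ℤ.* x ℤ.+ y) (f≗g k) (eval-cong f≗g ts)

  -- The combination of one multiple and one summand is the shape that the induction in `eval-swap`
  -- produces.
  eval-linear : ∀ f g c ts → eval (λ k → c ℤ.* f k ℤ.+ g k) ts ≡ c ℤ.* eval f ts ℤ.+ eval g ts
  eval-linear f g c []             = sym (trans (ℤ.+-identityʳ _) (ℤ.*-zeroʳ c))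
  eval-linear f g c ((d , k) ∷ ts) =
    trans (cong (ℤ._+_ (d ℤ.* (c ℤ.* f k ℤ.+ g k))) (eval-linear f g c ts))
          (solve 6 (λ c d x y s t →
             d :* (c :* x :+ y) :+ (c :* s :+ t) := c :* (d :* x :+ s) :+ (d :* y :+ t))
             refl c d (f k) (g k) (eval f ts) (eval g ts))
    where open +-*-Solver

  eval-0 : ∀ ts → eval (λ _ → 0ℤ) ts ≡ 0ℤ
  eval-0 []             = refl
  eval-0 ((c , _) ∷ ts) = cong₂ ℤ._+_ (ℤ.*-zeroʳ c) (eval-0 ts)

  -- Interchange of a finite double sum, from which commutativity of `*` follows.
  eval-swap : ∀ (h : Exponent → Exponent → ℤ) ts us →
    eval (λ k → eval (h k) us) ts ≡ eval (λ l → eval (λ k → h k l) ts) us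
  eval-swap h []             us = sym (eval-0 us)
  eval-swap h ((c , k) ∷ ts) us =
    trans (cong (ℤ._+_ (c ℤ.* eval (h k) us)) (eval-swap h ts us))
          (sym (eval-linear (h k) (λ l → eval (λ k → h k l) ts) c us))

  infixl 6 _⊞_
  _⊞_ : Exponent → Exponent → Exponent
  (k ⊞ l) v = k v ℕ.+ l v

  -- Turns the laws of `*` into statements about iterated `eval` and about addition of exponents.
  eval-* : ∀ f (p q : Poly V) →
    eval f (terms (p * q)) ≡ eval (λ k → eval (λ l → f (k ⊞ l)) (terms q)) (terms p)
  eval-* f (poly [])             q = refl
  eval-* f (poly ((c , k) ∷ ts)) q =
    trans (eval-++ f (map _ (terms q)) (terms (poly ts * q)))
          (cong₂ ℤ._+_ (scaled (terms q)) (eval-* f (poly ts) q))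
    where
    scaled : ∀ us → eval f (map (λ (d , l) → c ℤ.* d , k ⊞ l) us) ≡
                    c ℤ.* eval (λ l → f (k ⊞ l)) us
    scaled []             = sym (ℤ.*-zeroʳ c)
    scaled ((d , l) ∷ us) =
      trans (cong₂ ℤ._+_ (ℤ.*-assoc c d _) (scaled us)) (sym (ℤ.*-distribˡ-+ c _ _))

  ⊞-ext : ∀ {f} k → Extensional f → Extensional (λ l → f (k ⊞ l))
  ⊞-ext k f-ext l≗m = f-ext (λ v → cong (k v ℕ.+_) (l≗m v))

  eval-ext : ∀ {h : Exponent → Exponent → ℤ} ts → (∀ l → Extensional (λ k → h k l)) →
    Extensional (λ k → eval (h k) ts)
  eval-ext ts h-ext k≗l = eval-cong (λ m → h-ext m k≗l) ts

  -- `0# - p` reduces to the bare list of negated terms, so `p - q` and `p + (0- q)` agree by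
  -- computation and the solver's subtraction is that of `Poly`.
  0-_ : Poly V → Poly V
  0- p = 0# - p

  commutativeRing : CommutativeRing 0ℓ 0ℓ
  commutativeRing = record
    { _≈_ = _≃_ ; _+_ = _+_ ; _*_ = _*_ ; -_ = 0-_ ; 0# = 0# ; 1# = 1#
    ; isCommutativeRing = record
      { isRing = record
        { +-isAbelianGroup = record
          { isGroup = record
            { isMonoid = record
              { isSemigroup = record
                { isMagma = record
                  { isEquivalence = record
                    { refl  = functionals λ _ _ → refl
                    ; sym   = λ e → functionals λ f x → sym (agree e f x)
                    ; trans = λ d e → functionals λ f x → trans (agree d f x) (agree e f x)
                    }
                  ; ∙-cong = +-cong
                  }
                ; assoc = λ p q r → functionals λ f _ → +-assoc f p q r
                }
              ; identity = (λ p → functionals λ _ _ → refl)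
                         , (λ p → functionals λ f _ →
                              trans (eval-++ f (terms p) []) (ℤ.+-identityʳ _))
              }
            ; inverse = (λ p → functionals λ f _ →
                           trans (eval-++ f (terms (0- p)) _)
                           (trans (cong (ℤ._+ eval f (terms p)) (eval-neg f (terms p)))
                                  (ℤ.+-inverseˡ (eval f (terms p)))))
                      , (λ p → functionals λ f _ →
                           trans (eval-++ f (terms p) _)
                           (trans (cong (ℤ._+_ (eval f (terms p))) (eval-neg f (terms p)))
                                  (ℤ.+-inverseʳ (eval f (terms p)))))
            ; ⁻¹-cong = λ {p} {q} e → functionals λ f x →
                trans (eval-neg f (terms p))
                (trans (cong (λ z → ℤ.- z) (agree e f x)) (sym (eval-neg f (terms q))))
            }
          ; comm = λ p q → functionals λ f _ →
              trans (eval-++ f (terms p) _)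
              (trans (ℤ.+-comm (eval f (terms p)) _) (sym (eval-++ f (terms q) _)))
          }
        ; *-cong = *-cong
        ; *-assoc = λ p q r → functionals (*-assoc p q r)
        ; *-identity = (λ p → functionals (*-identityˡ p))
                     , (λ p → functionals λ f x → trans (*-comm p 1# f x) (*-identityˡ p f x))
        ; distrib = (λ p q r → functionals λ f x →
                       trans (*-comm p (q + r) f x) (trans (*-distribʳ p q r f)
                       (trans (cong₂ ℤ._+_ (*-comm q p f x) (*-comm r p f x))
                              (sym (eval-++ f (terms (p * q)) _)))))
                  , (λ p q r → functionals λ f x →
                       trans (*-distribʳ p q r f) (sym (eval-++ f (terms (q * p)) _)))
        }
      ; *-comm = λ p q → functionals (*-comm p q)
      }
    }
    where
    +-cong : ∀ {p p′ q q′} → p ≃ p′ → q ≃ q′ → p + q ≃ p′ + q′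
    +-cong {p} {p′} d e = functionals λ f x →
      trans (eval-++ f (terms p) _)
      (trans (cong₂ ℤ._+_ (agree d f x) (agree e f x)) (sym (eval-++ f (terms p′) _)))

    +-assoc : ∀ f p q r → eval f (terms (p + q + r)) ≡ eval f (terms (p + (q + r)))
    +-assoc f p q r = begin
      eval f (terms (p + q + r))   ≡⟨ eval-++ f (terms (p + q)) (terms r) ⟩
      eval f (terms (p + q)) ℤ.+ z ≡⟨ cong (ℤ._+ z) (eval-++ f (terms p) (terms q)) ⟩
      x ℤ.+ y ℤ.+ z                ≡⟨ ℤ.+-assoc x y z ⟩
      x ℤ.+ (y ℤ.+ z)              ≡⟨ cong (ℤ._+_ x) (eval-++ f (terms q) (terms r)) ⟨
      x ℤ.+ eval f (terms (q + r)) ≡⟨ eval-++ f (terms p) (terms (q + r)) ⟨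
      eval f (terms (p + (q + r))) ∎
      where
      open ≡-Reasoning
      x = eval f (terms p)
      y = eval f (terms q)
      z = eval f (terms r)

    *-comm : ∀ p q f → Extensional f → eval f (terms (p * q)) ≡ eval f (terms (q * p))
    *-comm p q f f-ext = begin
      eval f (terms (p * q))
        ≡⟨ eval-* f p q ⟩
      eval (λ k → eval (λ l → f (k ⊞ l)) (terms q)) (terms p)
        ≡⟨ eval-swap (λ k l → f (k ⊞ l)) (terms p) (terms q) ⟩
      eval (λ l → eval (λ k → f (k ⊞ l)) (terms p)) (terms q)
        ≡⟨ eval-cong (λ l → eval-cong (λ k →
             f-ext (λ v → ℕ.+-comm (k v) (l v))) (terms p)) (terms q) ⟩
      eval (λ l → eval (λ k → f (l ⊞ k)) (terms p)) (terms q)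
        ≡⟨ eval-* f q p ⟨
      eval f (terms (q * p)) ∎
      where open ≡-Reasoning

    *-cong : ∀ {p p′ q q′} → p ≃ p′ → q ≃ q′ → p * q ≃ p′ * q′
    *-cong {p} {p′} {q} {q′} d e = functionals λ f f-ext → begin
      eval f (terms (p * q))
        ≡⟨ eval-* f p q ⟩
      eval (λ k → eval (λ l → f (k ⊞ l)) (terms q)) (terms p)
        ≡⟨ eval-cong (λ k → agree e _ (⊞-ext k f-ext)) (terms p) ⟩
      eval (λ k → eval (λ l → f (k ⊞ l)) (terms q′)) (terms p)
        ≡⟨ agree d _ (eval-ext (terms q′) (λ l k≗m → f-ext (λ v → cong (ℕ._+ l v) (k≗m v)))) ⟩
      eval (λ k → eval (λ l → f (k ⊞ l)) (terms q′)) (terms p′)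
        ≡⟨ eval-* f p′ q′ ⟨
      eval f (terms (p′ * q′)) ∎
      where open ≡-Reasoning

    *-assoc : ∀ p q r f → Extensional f → eval f (terms (p * q * r)) ≡ eval f (terms (p * (q * r)))
    *-assoc p q r f f-ext = begin
      eval f (terms (p * q * r))
        ≡⟨ eval-* f (p * q) r ⟩
      eval (λ k → eval (λ m → f (k ⊞ m)) (terms r)) (terms (p * q))
        ≡⟨ eval-* (λ k → eval (λ m → f (k ⊞ m)) (terms r)) p q ⟩
      eval (λ k → eval (λ l → eval (λ m → f (k ⊞ l ⊞ m)) (terms r)) (terms q)) (terms p)
        ≡⟨ eval-cong (λ k → eval-cong (λ l → eval-cong (λ m →
             f-ext (λ v → ℕ.+-assoc (k v) (l v) (m v))) (terms r)) (terms q)) (terms p) ⟩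
      eval (λ k → eval (λ l → eval (λ m → f (k ⊞ (l ⊞ m))) (terms r)) (terms q)) (terms p)
        ≡⟨ eval-cong (λ k → eval-* (λ n → f (k ⊞ n)) q r) (terms p) ⟨
      eval (λ k → eval (λ n → f (k ⊞ n)) (terms (q * r))) (terms p)
        ≡⟨ eval-* f p (q * r) ⟨
      eval f (terms (p * (q * r))) ∎
      where open ≡-Reasoning

    *-identityˡ : ∀ p f → Extensional f → eval f (terms (1# * p)) ≡ eval f (terms p)
    *-identityˡ p f _ =
      trans (eval-* f 1# p) (trans (ℤ.+-identityʳ _) (ℤ.*-identityˡ (eval f (terms p))))

    *-distribʳ : ∀ p q r f → eval f (terms ((q + r) * p)) ≡
                             eval f (terms (q * p)) ℤ.+ eval f (terms (r * p))
    *-distribʳ p q r f =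
      trans (eval-* f (q + r) p)
      (trans (eval-++ (λ k → eval (λ l → f (k ⊞ l)) (terms p)) (terms q) (terms r))
            (sym (cong₂ ℤ._+_ (eval-* f q p) (eval-* f r p))))

  private
    eval-const : ∀ f c → eval f (terms (const {V} c)) ≡ c ℤ.* f (λ _ → 0)
    eval-const _ _ = ℤ.+-identityʳ _

  const-*-homo : ∀ c d → const (c ℤ.* d) ≃ const c * const d
  const-*-homo c d = functionals λ _ _ → refl

  const-morphism : ℤ.+-*-rawRing -Raw-AlmostCommutative⟶ fromCommutativeRing commutativeRing
  const-morphism = record
    { ⟦_⟧    = const
    ; +-homo = λ c d → functionals λ f _ → trans (eval-const f (c ℤ.+ d))
        (trans (ℤ.*-distribʳ-+ _ c d) (cong (ℤ._+_ (c ℤ.* f _)) (sym (eval-const f d))))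
    ; *-homo = const-*-homo
    ; -‿homo = λ _ → functionals λ _ _ → refl
    ; 0-homo = functionals λ _ _ → refl
    ; 1-homo = functionals λ _ _ → refl
    }

  const≟ : ∀ c d → Maybe (const c ≃ const d)
  const≟ c d = Maybe.map (λ { refl → functionals λ _ _ → refl }) (dec⇒maybe (c ℤ.≟ d))

  module Solver = RingSolver
    ℤ.+-*-rawRing (fromCommutativeRing commutativeRing) const-morphism const≟

-- Finite sums and products

module _ (M : CommutativeMonoid 0ℓ 0ℓ) where
  open CommutativeMonoid M
    using (Carrier; _∙_; ε; ∙-congˡ; identityˡ; assoc; setoid; isEquivalence; isCommutativeMonoid)
    renaming (refl to ∼-refl; trans to ∼-trans; sym to ∼-sym; _≈_ to _∼_)

  -- Writing `ε` for the omitted entries makes the index list independent of the predicate, so folds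
  -- over different filters can be compared entry by entry.
  fold-filter : ∀ {A : Set} {P : Pred A 0ℓ} (P? : Decidable P) (f : A → Carrier) xs →
    foldr _∙_ ε (map f (filter P? xs)) ∼
    foldr _∙_ ε (map (λ x → if does (P? x) then f x else ε) xs)
  fold-filter P? f []       = ∼-refl
  fold-filter P? f (x ∷ xs) with does (P? x)
  ... | true  = ∙-congˡ (fold-filter P? f xs)
  ... | false = ∼-trans (fold-filter P? f xs) (∼-sym (identityˡ _))

  fold-++ : ∀ xs ys → foldr _∙_ ε (xs ++ ys) ∼ foldr _∙_ ε xs ∙ foldr _∙_ ε ys
  fold-++ []       ys = ∼-sym (identityˡ _)
  fold-++ (x ∷ xs) ys = ∼-trans (∙-congˡ (fold-++ xs ys)) (∼-sym (assoc x _ _))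

  fold-↭ : ∀ {A : Set} (f : A → Carrier) {xs ys} → xs ↭ ys →
    foldr _∙_ ε (map f xs) ∼ foldr _∙_ ε (map f ys)
  fold-↭ f xs↭ys = Permutation.foldr-commMonoid setoid isCommutativeMonoid
    (↭⇒↭ₛ′ isEquivalence (↭.map⁺ f xs↭ys))

module ListFolds (R : CommutativeRing 0ℓ 0ℓ) where
  open CommutativeRing R public
    using (setoid; +-cong; +-assoc; +-comm; +-identityʳ; -‿cong;
           *-cong; *-congˡ; *-congʳ; *-assoc; *-identityˡ; *-identityʳ;
           zeroˡ; zeroʳ; distribˡ; distribʳ;
           +-commutativeMonoid; *-commutativeMonoid; +-abelianGroup)
    renaming (Carrier to K; _≈_ to _∼_; _+_ to _⊕_; _*_ to _⊗_; -_ to ⊖_; 0# to 𝟘; 1# to 𝟙;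
              refl to ∼-refl; sym to ∼-sym; trans to ∼-trans; reflexive to ∼-reflexive)
  open CommutativeRing R using (*-commutativeSemigroup; +-commutativeSemigroup)
  open CommutativeSemigroupProperties *-commutativeSemigroup
    public using () renaming (interchange to *-interchange)
  open CommutativeSemigroupProperties +-commutativeSemigroup
    public using () renaming (interchange to +-interchange)

  ∑ ∏ : List K → K
  ∑ = foldr _⊕_ 𝟘
  ∏ = foldr _⊗_ 𝟙

  ∑-filter : ∀ {A : Set} {P : Pred A 0ℓ} (P? : Decidable P) (f : A → K) xs →
    ∑ (map f (filter P? xs)) ∼ ∑ (map (λ x → if does (P? x) then f x else 𝟘) xs)
  ∑-filter = fold-filter +-commutativeMonoid

  ∏-filter : ∀ {A : Set} {P : Pred A 0ℓ} (P? : Decidable P) (f : A → K) xs →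
    ∏ (map f (filter P? xs)) ∼ ∏ (map (λ x → if does (P? x) then f x else 𝟙) xs)
  ∏-filter = fold-filter *-commutativeMonoid

  ∑-++ : ∀ xs ys → ∑ (xs ++ ys) ∼ ∑ xs ⊕ ∑ ys
  ∑-++ = fold-++ +-commutativeMonoid

  ∏-↭ : ∀ {A : Set} (f : A → K) {xs ys} → xs ↭ ys → ∏ (map f xs) ∼ ∏ (map f ys)
  ∏-↭ = fold-↭ *-commutativeMonoid

  ∑-cong : ∀ {A : Set} {f g : A → K} {xs} → All (λ x → f x ∼ g x) xs → ∑ (map f xs) ∼ ∑ (map g xs)
  ∑-cong []       = ∼-refl
  ∑-cong (e ∷ es) = +-cong e (∑-cong es)

  ∏-cong : ∀ {A : Set} {f g : A → K} {xs} → All (λ x → f x ∼ g x) xs → ∏ (map f xs) ∼ ∏ (map g xs)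
  ∏-cong []       = ∼-refl
  ∏-cong (e ∷ es) = *-cong e (∏-cong es)

  ∏-⊗ : ∀ {A : Set} (f g : A → K) xs → ∏ (map (λ x → f x ⊗ g x) xs) ∼ ∏ (map f xs) ⊗ ∏ (map g xs)
  ∏-⊗ f g []       = ∼-sym (*-identityˡ 𝟙)
  ∏-⊗ f g (x ∷ xs) = ∼-trans (*-congˡ (∏-⊗ f g xs)) (*-interchange (f x) (g x) _ _)

  ∏-𝟙 : ∀ {A : Set} {f : A → K} {xs} → All (λ x → f x ∼ 𝟙) xs → ∏ (map f xs) ∼ 𝟙
  ∏-𝟙 []         = ∼-refl
  ∏-𝟙 (fx ∷ fxs) = ∼-trans (*-cong fx (∏-𝟙 fxs)) (*-identityˡ 𝟙)

-- Substitution homomorphisms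

module Substitution {W V : FiniteSet} (σ : FiniteSet.Carrier W → Poly V) where
  open FiniteSet W
  open PolynomialRing V
  open Poly
  open ListFolds commutativeRing
  open SetoidReasoning setoid

  extend : Poly W → Poly V
  extend = substitute {W} σ

  monomial : (Carrier → ℕ) → Poly V
  monomial k = product (map (λ w → σ w ^ k w) elements)

  term : ℤ × (Carrier → ℕ) → Poly V
  term (c , k) = const c * monomial k

  ^-distrib-+ : ∀ (p : Poly V) m n → p ^ (m ℕ.+ n) ≃ p ^ m * p ^ n
  ^-distrib-+ p zero    n = ∼-sym (*-identityˡ (p ^ n))
  ^-distrib-+ p (suc m) n = begin
    p * p ^ (m ℕ.+ n)   ≈⟨ *-congˡ {p} (^-distrib-+ p m n) ⟩
    p * (p ^ m * p ^ n) ≈⟨ *-assoc p (p ^ m) (p ^ n) ⟨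
    p * p ^ m * p ^ n   ∎

  monomial-+ : ∀ k l → monomial (λ w → k w ℕ.+ l w) ≃ monomial k * monomial l
  monomial-+ k l = begin
    monomial (λ w → k w ℕ.+ l w)
      ≈⟨ ∏-cong (All.universal (λ w → ^-distrib-+ (σ w) (k w) (l w)) elements) ⟩
    product (map (λ w → σ w ^ k w * σ w ^ l w) elements)
      ≈⟨ ∏-⊗ (λ w → σ w ^ k w) (λ w → σ w ^ l w) elements ⟩
    monomial k * monomial l ∎

  substitute-+ : ∀ p q → extend (p + q) ≃ extend p + extend q
  substitute-+ p q = ∼-trans (∼-reflexive (cong sum (map-++ term (terms p) (terms q))))
    (∑-++ (map term (terms p)) (map term (terms q)))

  -- By induction on the terms of the left factor: multiplication by a single term shifts every term
  -- of `q`, and `monomial` takes sums of exponents to products.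
  substitute-* : ∀ p q → extend (p * q) ≃ extend p * extend q
  substitute-* (poly [])             q = ∼-sym (zeroˡ (extend q))
  substitute-* (poly ((c , k) ∷ ts)) q = begin
    extend (poly ((c , k) ∷ ts) * q)
      ≈⟨ substitute-+ (poly (map _ (terms q))) (poly ts * q) ⟩
    extend (poly (map (shift c k) (terms q))) + extend (poly ts * q)
      ≈⟨ +-cong (shifted (terms q)) (substitute-* (poly ts) q) ⟩
    term (c , k) * extend q + extend (poly ts) * extend q
      ≈⟨ distribʳ (extend q) (term (c , k)) (extend (poly ts)) ⟨
    extend (poly ((c , k) ∷ ts)) * extend q ∎
    where
    shift : ℤ → (Carrier → ℕ) → ℤ × (Carrier → ℕ) → ℤ × (Carrier → ℕ)
    shift c k (d , l) = c ℤ.* d , λ w → k w ℕ.+ l w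

    term-shift : ∀ d l → term (shift c k (d , l)) ≃ term (c , k) * term (d , l)
    term-shift d l = begin
      const (c ℤ.* d) * monomial (λ w → k w ℕ.+ l w)
        ≈⟨ *-cong (const-*-homo c d) (monomial-+ k l) ⟩
      const c * const d * (monomial k * monomial l)
        ≈⟨ *-interchange (const c) (const d) (monomial k) (monomial l) ⟩
      term (c , k) * term (d , l) ∎

    shifted : ∀ us → extend (poly (map (shift c k) us)) ≃ term (c , k) * extend (poly us)
    shifted []             = ∼-sym (zeroʳ (term (c , k)))
    shifted ((d , l) ∷ us) = begin
      term (shift c k (d , l)) + extend (poly (map (shift c k) us))
        ≈⟨ +-cong (term-shift d l) (shifted us) ⟩
      term (c , k) * term (d , l) + term (c , k) * extend (poly us)
        ≈⟨ distribˡ (term (c , k)) (term (d , l)) (extend (poly us)) ⟨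
      term (c , k) * (term (d , l) + extend (poly us)) ∎

  -- Completeness of `elements` provides the factor `σ v`, and uniqueness makes all the other
  -- factors zeroth powers.
  monomial-var : ∀ v → monomial (λ w → if does (v ≟ w) then 1 else 0) ≃ σ v
  monomial-var v = select elements (complete v) unique
    where
    power : Carrier → Poly V
    power w = σ w ^ (if does (v ≟ w) then 1 else 0)

    power≢ : ∀ {w} → v ≢ w → power w ≃ 1#
    power≢ {w} v≢w = ∼-reflexive (cong (λ b → σ w ^ (if b then 1 else 0)) (dec-false (v ≟ w) v≢w))

    power≡ : power v ≃ σ v
    power≡ = ∼-trans (∼-reflexive (cong (λ b → σ v ^ (if b then 1 else 0)) (dec-true (v ≟ v) refl)))
                     (*-identityʳ (σ v))

    select : ∀ ws → v ∈ ws → Unique ws → product (map power ws) ≃ σ v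
    select (v ∷ ws) (here refl) (v∉ws ∷ _) = begin
      power v * product (map power ws) ≈⟨ *-cong power≡ (∏-𝟙 (All.map power≢ v∉ws)) ⟩
      σ v * 1#                         ≈⟨ *-identityʳ (σ v) ⟩
      σ v                              ∎
    select (w ∷ ws) (there v∈ws) (w∉ws ∷ u) = begin
      power w * product (map power ws)
        ≈⟨ *-cong (power≢ (All.lookup w∉ws v∈ws ∘ sym)) (select ws v∈ws u) ⟩
      1# * σ v ≈⟨ *-identityˡ (σ v) ⟩
      σ v      ∎

  substitute-monomial : ∀ k → extend (poly ((1ℤ , k) ∷ [])) ≃ monomial k
  substitute-monomial k = ∼-trans (+-identityʳ (1# * monomial k)) (*-identityˡ (monomial k))

  substitute-var : ∀ v → extend (var v) ≃ σ v
  substitute-var v = ∼-trans (substitute-monomial _) (monomial-var v)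

  substitute-product : ∀ vs → extend (product (map var vs)) ≃ product (map σ vs)
  substitute-product []       = ∼-trans (substitute-monomial (λ _ → 0))
    (∏-𝟙 (All.universal (λ _ → ∼-refl {1#}) elements))
  substitute-product (v ∷ vs) = ∼-trans (substitute-* (var v) (product (map var vs)))
    (*-cong (substitute-var v) (substitute-product vs))

  substitute-sum : ∀ {A : Set} (f : A → Poly W) (g : A → Poly V) →
    (∀ x → extend (f x) ≃ g x) → ∀ xs → extend (sum (map f xs)) ≃ sum (map g xs)
  substitute-sum f g f↦g []       = ∼-refl {0#}
  substitute-sum f g f↦g (x ∷ xs) = ∼-trans (substitute-+ (f x) (sum (map f xs)))
    (+-cong (f↦g x) (substitute-sum f g f↦g xs))

-- Paths, cycles and sinks

module _ {A : Set} where

  -- As lists of arcs, orientations of all the graphs involved are related by list operations: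
  -- consing an arc for e, permuting, mapping along the contraction.
  ArcList : Set
  ArcList = List (A × A)

  -- Closed walks replace cycles through distinct vertices, because they can be concatenated,
  -- rotated and mapped without care for repeated vertices. The two notions are linked by
  -- `cycle⇔closure`.
  Cyclic : ArcList → Set
  Cyclic as = ∃[ v ] TransClosure (Arcs as) v v

  Sink : ArcList → A → Set
  Sink as v = All (λ (t , h) → t ≡ v ⊎ h ≡ v → h ≡ v) as

  path-⊆ : ∀ {as bs : ArcList} → (∀ {x} → x ∈ as → x ∈ bs) →
    ∀ {x y} → TransClosure (Arcs as) x y → TransClosure (Arcs bs) x y
  path-⊆ as⊆bs [ r ]    = [ as⊆bs r ]
  path-⊆ as⊆bs (r ∷ rs) = as⊆bs r ∷ path-⊆ as⊆bs rs

  cyclic-⊆ : ∀ {as bs : ArcList} → (∀ {x} → x ∈ as → x ∈ bs) → Cyclic as → Cyclic bs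
  cyclic-⊆ as⊆bs = Product.map₂ (path-⊆ as⊆bs)

  cyclic-closing : ∀ {a b} {as : ArcList} → TransClosure (Arcs as) b a → Cyclic ((a , b) ∷ as)
  cyclic-closing b⇝a = _ , here refl ∷ path-⊆ there b⇝a

  infix 4 _⊢_⇝*_
  _⊢_⇝*_ : ArcList → A → A → Set
  as ⊢ x ⇝* y = x ≡ y ⊎ TransClosure (Arcs as) x y

  ⇝*-trans : ∀ {as x y z} → as ⊢ x ⇝* y → as ⊢ y ⇝* z → as ⊢ x ⇝* z
  ⇝*-trans (inj₁ refl) q           = q
  ⇝*-trans (inj₂ p)    (inj₁ refl) = inj₂ p
  ⇝*-trans (inj₂ p)    (inj₂ q)    = inj₂ (p TC.++ q)

  -- If the path uses the new arc, keep the part before its first use and the part after its last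
  -- use; whatever lies between is discarded.
  path-∷⁻ : ∀ {a b as x y} → TransClosure (Arcs ((a , b) ∷ as)) x y →
    TransClosure (Arcs as) x y ⊎ as ⊢ x ⇝* a × as ⊢ b ⇝* y
  path-∷⁻ [ here refl ] = inj₂ (inj₁ refl , inj₁ refl)
  path-∷⁻ [ there r ]   = inj₁ [ r ]
  path-∷⁻ (here refl ∷ rs) with path-∷⁻ rs
  ... | inj₁ q       = inj₂ (inj₁ refl , inj₂ q)
  ... | inj₂ (_ , q) = inj₂ (inj₁ refl , q)
  path-∷⁻ (there r ∷ rs) with path-∷⁻ rs
  ... | inj₁ q       = inj₁ (r ∷ q)
  ... | inj₂ (p , q) = inj₂ (⇝*-trans (inj₂ [ r ]) p , q)

  -- A closed walk through the new arc is rotated so as to start at `b`.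
  cyclic-∷⁻ : ∀ {a b as} → Cyclic ((a , b) ∷ as) → Cyclic as ⊎ as ⊢ b ⇝* a
  cyclic-∷⁻ (v , c) with path-∷⁻ c
  ... | inj₁ d       = inj₁ (v , d)
  ... | inj₂ (p , q) = inj₂ (⇝*-trans q p)

  -- An arc can violate the sink condition only at its tail.
  sink-∷ : ∀ {a b as v} → a ≢ v → Sink ((a , b) ∷ as) v ⇔ Sink as v
  sink-∷ a≢v = mk⇔ (λ { (_ ∷ s) → s })
    ((λ { (inj₁ a≡v) → contradiction a≡v a≢v ; (inj₂ b≡v) → b≡v }) ∷_)

  -- The ends must differ: a loop at `a` has head `a` and satisfies the sink condition there.
  tail-not-sink : ∀ {a b as} → a ≢ b → ¬ Sink ((a , b) ∷ as) a
  tail-not-sink a≢b (s ∷ _) = a≢b (sym (s (inj₁ refl)))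

  -- At a sink `x`, the first arc of the path would have head `x` and so be a loop, which is a
  -- cycle.
  source-not-sink : ∀ {as x y} → ¬ Cyclic as → TransClosure (Arcs as) x y → ¬ Sink as x
  source-not-sink {as} {x} acyclic path sink = acyclic (x , [ loop path ])
    where
    loop : ∀ {y} → TransClosure (Arcs as) x y → (x , x) ∈ as
    loop [ r ]   = subst (λ h → (x , h) ∈ as) (All.lookup sink r (inj₁ refl)) r
    loop (r ∷ _) = subst (λ h → (x , h) ∈ as) (All.lookup sink r (inj₁ refl)) r

-- A path in the image of a map π all of whose nontrivial fibres lie inside U.
-- If no path of the original digraph joins two points of U, then the lift can
-- jump inside U only at its first arc, at its last arc or once in between.
module _ {A B : Set} (π : A → B) (U : A → Set)
         (fibre : ∀ {a b} → π a ≡ π b → a ≡ b ⊎ U a × U b)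
         {as : List (A × A)} (separated : ∀ {u w} → U u → U w → ¬ TransClosure (Arcs as) u w) where
  private
    infix 4 _⇝_
    _⇝_ : A → A → Set
    _⇝_ = TransClosure (Arcs as)

  data Lift (a b : A) : Set where
    jumpless : a ⇝ b → Lift a b
    jump-in  : ∀ {u} → U a → U u → u ⇝ b → Lift a b
    jump-out : ∀ {u} → U b → U u → a ⇝ u → Lift a b
    jump     : ∀ {u w} → U u → U w → a ⇝ u → w ⇝ b → Lift a b

  -- Two successive jumps would enclose a genuine path between two points of `U`; this refutes every
  -- shape missing from `Lift`. The remaining path is lifted from the actual head `h` of the first
  -- arc, so a jump right after that arc appears as `jump-in`.
  lift-path : ∀ {x y} → TransClosure (Arcs (map (Product.map π π) as)) x y →
    ∀ {a b} → x ≡ π a → y ≡ π b → Lift a b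
  lift-path [ r ] x≡πa y≡πb with ∈-map⁻ (Product.map π π) r
  ... | (t , h) , arc , refl with fibre x≡πa | fibre y≡πb
  ... | inj₁ refl      | inj₁ refl      = jumpless [ arc ]
  ... | inj₁ refl      | inj₂ (Uh , Ub) = jump-out Ub Uh [ arc ]
  ... | inj₂ (Ut , Ua) | inj₁ refl      = jump-in Ua Ut [ arc ]
  ... | inj₂ (Ut , Ua) | inj₂ (Uh , Ub) = contradiction [ arc ] (separated Ut Uh)
  lift-path (r ∷ rs) x≡πa y≡πb with ∈-map⁻ (Product.map π π) r
  ... | (t , h) , arc , refl with fibre x≡πa | lift-path rs refl y≡πb
  ... | inj₁ refl      | jumpless p        = jumpless (arc ∷ p)
  ... | inj₁ refl      | jump-in Uh Uu p   = jump Uh Uu [ arc ] p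
  ... | inj₁ refl      | jump-out Ub Uu p  = jump-out Ub Uu (arc ∷ p)
  ... | inj₁ refl      | jump Uu Uw p q    = jump Uu Uw (arc ∷ p) q
  ... | inj₂ (Ut , Ua) | jumpless p        = jump-in Ua Ut (arc ∷ p)
  ... | inj₂ (Ut , Ua) | jump-in Uh Uu p   = contradiction [ arc ] (separated Ut Uh)
  ... | inj₂ (Ut , Ua) | jump-out Ub Uu p  = contradiction (arc ∷ p) (separated Ut Uu)
  ... | inj₂ (Ut , Ua) | jump Uu Uw p q    = contradiction (arc ∷ p) (separated Ut Uu)

  -- The cycle is lifted with the same point `a` at both ends. Without jumps the lift is a cycle;
  -- with jumps, its pieces, joined at `a`, form a path between two points of `U`.
  acyclic-map : (∀ b → ∃[ a ] b ≡ π a) → ¬ Cyclic as → ¬ Cyclic (map (Product.map π π) as)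
  acyclic-map onto acyclic (v , c) with onto v
  ... | a , v≡πa with lift-path c v≡πa v≡πa
  ... | jumpless p       = acyclic (a , p)
  ... | jump-in Ua Uu p  = separated Uu Ua p
  ... | jump-out Ua Uu p = separated Ua Uu p
  ... | jump Uu Uw p q   = separated Uw Uu (q TC.++ p)

path-map : ∀ {A B : Set} (π : A → B) {as : List (A × A)} {x y} →
  TransClosure (Arcs as) x y → TransClosure (Arcs (map (Product.map π π) as)) (π x) (π y)
path-map π [ r ]    = [ ∈-map⁺ (Product.map π π) r ]
path-map π (r ∷ rs) = ∈-map⁺ (Product.map π π) r ∷ path-map π rs

cyclic-map : ∀ {A B : Set} (π : A → B) {as : List (A × A)} {x y} → π x ≡ π y →
  TransClosure (Arcs as) x y → Cyclic (map (Product.map π π) as)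
cyclic-map π {x = x} πx≡πy p = π x , subst (TransClosure _ (π x)) (sym πx≡πy) (path-map π p)

-- Sums over orientations

module Orientations (R : CommutativeRing 0ℓ 0ℓ) where
  open ListFolds R
  open SetoidReasoning setoid

  -- Recursion on the edge list avoids direction vectors, whose length changes whenever an edge is
  -- removed; the arcs chosen so far are absorbed into `F`.
  ∑-orientations : ∀ {A : Set} → (List (A × A) → K) → List (A × A) → K
  ∑-orientations F []       = F []
  ∑-orientations F (a ∷ as) =
    ∑-orientations (F ∘ (a ∷_)) as ⊕ ∑-orientations (F ∘ (reverse a ∷_)) as

  ∑-orientations-cong : ∀ {A : Set} {F G : List (A × A) → K} → (∀ as → F as ∼ G as) →
    ∀ as → ∑-orientations F as ∼ ∑-orientations G as
  ∑-orientations-cong F∼G []       = F∼G []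
  ∑-orientations-cong F∼G (a ∷ as) =
    +-cong (∑-orientations-cong (F∼G ∘ (a ∷_)) as) (∑-orientations-cong (F∼G ∘ (reverse a ∷_)) as)

  ∑-orientations-⊕ : ∀ {A : Set} (F G : List (A × A) → K) as →
    ∑-orientations (λ bs → F bs ⊕ G bs) as ∼ ∑-orientations F as ⊕ ∑-orientations G as
  ∑-orientations-⊕ F G []       = ∼-refl
  ∑-orientations-⊕ F G (a ∷ as) = ∼-trans
    (+-cong (∑-orientations-⊕ (F ∘ (a ∷_)) (G ∘ (a ∷_)) as)
            (∑-orientations-⊕ (F ∘ (reverse a ∷_)) (G ∘ (reverse a ∷_)) as))
    (+-interchange _ _ _ _)

  ∑-orientations-map : ∀ {A B : Set} (π : A → B) F as →
    ∑-orientations F (map (Product.map π π) as) ∼ ∑-orientations (F ∘ map (Product.map π π)) as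
  ∑-orientations-map π F []       = ∼-refl
  ∑-orientations-map π F (a ∷ as) =
    +-cong (∑-orientations-map π (F ∘ (Product.map π π a ∷_)) as)
           (∑-orientations-map π (F ∘ (reverse (Product.map π π a) ∷_)) as)

  -- Brings a chosen edge to the front, where the recursion separates its two directions. The order
  -- of the arcs then changes, hence the invariance required of `F`.
  ∑-orientations-removeAt : ∀ {A : Set} (F : List (A × A) → K) →
    (∀ {as bs} → as ↭ bs → F as ∼ F bs) → ∀ as (i : Fin (length as)) →
    ∑-orientations F as ∼ ∑-orientations F (lookup as i ∷ removeAt as i)
  ∑-orientations-removeAt F F-↭ (a ∷ as) zero    = ∼-refl
  ∑-orientations-removeAt F F-↭ (a ∷ as) (suc i) = begin
    ∑-orientations (F ∘ (a ∷_)) as ⊕ ∑-orientations (F ∘ (reverse a ∷_)) as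
      ≈⟨ +-cong (∑-orientations-removeAt (F ∘ (a ∷_)) (F-↭ ∘ prep a) as i)
                (∑-orientations-removeAt (F ∘ (reverse a ∷_)) (F-↭ ∘ prep (reverse a)) as i) ⟩
    (S a b ⊕ S a (reverse b)) ⊕ (S (reverse a) b ⊕ S (reverse a) (reverse b))
      -- Regroup the four sums by the direction of `b` instead of that of `a`.
      ≈⟨ +-interchange _ _ _ _ ⟩
    (S a b ⊕ S (reverse a) b) ⊕ (S a (reverse b) ⊕ S (reverse a) (reverse b))
      ≈⟨ +-cong (+-cong (exchange a b) (exchange (reverse a) b))
                (+-cong (exchange a (reverse b)) (exchange (reverse a) (reverse b))) ⟩
    (S b a ⊕ S b (reverse a)) ⊕ (S (reverse b) a ⊕ S (reverse b) (reverse a)) ∎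
    where
    b = lookup as i
    S = λ x y → ∑-orientations (λ bs → F (x ∷ y ∷ bs)) (removeAt as i)
    exchange : ∀ x y → S x y ∼ S y x
    exchange x y = ∑-orientations-cong (λ bs → F-↭ (swap x y ↭-refl)) (removeAt as i)

  ∑-directions : ∀ {A : Set} (F : List (A × A) → K) es →
    ∑ (map (λ o → F (zipWith direct es (Vec.toList o))) (allDirections (length es))) ∼
    ∑-orientations F es
  ∑-directions F []       = +-identityʳ (F [])
  ∑-directions F (e ∷ es) = begin
    ∑ (map H (map (forward Vec.∷_) os ++ map (backward Vec.∷_) os ++ []))
      -- The trailing `[]` is left over by `cartesianProductWith` on the two-element list of
      -- directions.
      ≈⟨ ∼-reflexive (cong (λ l → ∑ (map H (map (forward Vec.∷_) os ++ l))) (++-identityʳ _)) ⟩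
    ∑ (map H (map (forward Vec.∷_) os ++ map (backward Vec.∷_) os))
      ≈⟨ ∼-reflexive (cong ∑ (map-++ H (map (forward Vec.∷_) os) _)) ⟩
    ∑ (map H (map (forward Vec.∷_) os) ++ map H (map (backward Vec.∷_) os))
      ≈⟨ ∑-++ (map H (map (forward Vec.∷_) os)) _ ⟩
    ∑ (map H (map (forward Vec.∷_) os)) ⊕ ∑ (map H (map (backward Vec.∷_) os))
      ≈⟨ ∼-reflexive (cong₂ (λ xs ys → ∑ xs ⊕ ∑ ys) (map-∘ os) (map-∘ os)) ⟨
    ∑ (map (H ∘ (forward Vec.∷_)) os) ⊕ ∑ (map (H ∘ (backward Vec.∷_)) os)
      ≈⟨ +-cong (∑-directions (F ∘ (e ∷_)) es) (∑-directions (F ∘ (reverse e ∷_)) es) ⟩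
    ∑-orientations F (e ∷ es) ∎
    where
    os = allDirections (length es)
    H = λ o → F (zipWith direct (e ∷ es) (Vec.toList o))

-- Contraction of a pair of vertices

unique-↭ : ∀ {A : Set} {xs ys : List A} → Unique xs → Unique ys →
  (∀ {x} → x ∈ xs → x ∈ ys) → (∀ {x} → x ∈ ys → x ∈ xs) → xs ↭ ys
unique-↭ xs! ys! xs⊆ys ys⊆xs = ∼bag⇒↭ (unique∧set⇒bag xs! ys! (mk⇔ xs⊆ys ys⊆xs))

module Contraction (V : FiniteSet) (u₁ u₂ : FiniteSet.Carrier V) (u₁≢u₂ : u₁ ≢ u₂) where
  open FiniteSet V

  private
    module M = FiniteSet (merged V u₁ u₂)

  π : Carrier → Merged u₁ u₂
  π = merge V u₁ u₂

  End : Carrier → Set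
  End v = v ≡ u₁ ⊎ v ≡ u₂

  -- Records the value of `π` along with the case, so that later proofs need not repeat the two
  -- equality tests inside `merge`.
  data View (v : Carrier) : Set where
    end   : End v → π v ≡ vₑ → View v
    other : (p : v ≢ u₁) (q : v ≢ u₂) → π v ≡ old v p q → View v

  view : ∀ v → View v
  view v with v ≟ u₁ | v ≟ u₂
  ... | yes refl | _        = end (inj₁ refl) (merge-u₁ V u₁ u₂)
  ... | no p     | yes refl = end (inj₂ refl) merge-u₂
    where
    merge-u₂ : π u₂ ≡ vₑ
    merge-u₂ with u₂ ≟ u₁ | u₂ ≟ u₂
    ... | yes _ | _     = refl
    ... | no _  | yes _ = refl
    ... | no _  | no ¬r = contradiction refl ¬r
  ... | no p     | no q     = other p q (merge-old V u₁ u₂ v p q)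

  π-end : ∀ {v} → End v → π v ≡ vₑ
  π-end {v} e with view v
  ... | end _ πv≡vₑ = πv≡vₑ
  ... | other p q _ = [ (λ r → contradiction r p) , (λ r → contradiction r q) ]′ e

  π-end⁻ : ∀ {v} → π v ≡ vₑ → End v
  π-end⁻ {v} πv≡vₑ with view v
  ... | end e _ = e
  ... | other _ _ πv≡old with () ← trans (sym πv≡vₑ) πv≡old

  π-other⁻ : ∀ {v w p q} → π w ≡ old v p q → w ≡ v
  π-other⁻ {v} {w} πw≡old with view w
  ... | end _ πw≡vₑ with () ← trans (sym πw≡vₑ) πw≡old
  π-other⁻ πw≡old | other _ _ πw≡old′ with refl ← trans (sym πw≡old′) πw≡old = refl

  fibre : ∀ {v w} → π v ≡ π w → v ≡ w ⊎ End v × End w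
  fibre {v} {w} πv≡πw with view w
  ... | end e πw≡vₑ      = inj₂ (π-end⁻ (trans πv≡πw πw≡vₑ) , e)
  ... | other _ _ πw≡old = inj₁ (π-other⁻ (trans πv≡πw πw≡old))

  -- A section of `π`. Since it picks `u₁` above `vₑ`, the vertex `u₂` is the one missed and is
  -- added by hand in `elements-↭`.
  representative : Merged u₁ u₂ → Carrier
  representative vₑ          = u₁
  representative (old v _ _) = v

  π-representative : ∀ x → x ≡ π (representative x)
  π-representative vₑ          = sym (merge-u₁ V u₁ u₂)
  π-representative (old v p q) = sym (merge-old V u₁ u₂ v p q)

  -- The part common to both vertex sets: products over either one are rewritten as a product over
  -- this list times the factors at `vₑ`, or at `u₂` and `u₁`.
  others : List (Merged u₁ u₂)
  others = filter (λ x → ¬? (x M.≟ vₑ)) M.elements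

  others-≢vₑ : All (_≢ vₑ) others
  others-≢vₑ = all-filter (λ x → ¬? (x M.≟ vₑ)) M.elements

  merged-elements-↭ : M.elements ↭ vₑ ∷ others
  merged-elements-↭ = unique-↭ M.unique
    (All.map (λ x≢vₑ → x≢vₑ ∘ sym) others-≢vₑ ∷ Unique.filter⁺ (λ x → ¬? (x M.≟ vₑ)) M.unique)
    (λ {x} _ → member x) (λ {x} _ → M.complete x)
    where
    member : ∀ x → x ∈ vₑ ∷ others
    member x with x M.≟ vₑ
    ... | yes x≡vₑ = here x≡vₑ
    ... | no  x≢vₑ = there (∈-filter⁺ (λ x → ¬? (x M.≟ vₑ)) (M.complete x) x≢vₑ)

  representative-injective : ∀ {x y} → representative x ≡ representative y → x ≡ y
  representative-injective {x} {y} eq =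
    trans (π-representative x) (trans (cong π eq) (sym (π-representative y)))

  elements-↭ : elements ↭ u₂ ∷ u₁ ∷ map representative others
  elements-↭ = ↭-trans
    (unique-↭ unique
      (¬Any⇒All¬ _ u₂∉ ∷ Unique.map⁺ representative-injective M.unique)
      (λ {v} _ → member v) (λ {v} _ → complete v))
    (prep u₂ (↭.map⁺ representative merged-elements-↭))
    where
    u₂∉ : u₂ ∉ map representative M.elements
    u₂∉ u₂∈ with ∈-map⁻ representative u₂∈
    ... | vₑ        , _ , eq = u₁≢u₂ (sym eq)
    ... | old _ _ q , _ , eq = q (sym eq)

    member : ∀ v → v ∈ u₂ ∷ map representative M.elements
    member v with view v
    ... | end (inj₁ refl) _ = there (∈-map⁺ representative (M.complete vₑ))
    ... | end (inj₂ refl) _ = here refl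
    ... | other p q _       = there (∈-map⁺ representative (M.complete (old v p q)))

  contract : List (Carrier × Carrier) → List (Merged u₁ u₂ × Merged u₁ u₂)
  contract = map (Product.map π π)

  -- The fibre of `π` over an old vertex is a single point, so the condition transfers arc by arc.
  sink-other : ∀ {as v p q} → Sink (contract as) (old v p q) ⇔ Sink as v
  sink-other {as} {v} {p} {q} = mk⇔
    (λ s → All.map (λ f → π-other⁻ ∘ f ∘ [ inj₁ ∘ lift , inj₂ ∘ lift ]′) (map⁻ s))
    (λ s → map⁺ (All.map (λ f → lift ∘ f ∘ [ inj₁ ∘ π-other⁻ , inj₂ ∘ π-other⁻ ]′) s))
    where
    lift : ∀ {w} → w ≡ v → π w ≡ old v p q
    lift refl = merge-old V u₁ u₂ v p q

  -- An arc from an end to an end would become a loop at `vₑ`, invisible to the sink condition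
  -- there; `separated` excludes such arcs.
  sink-vₑ : ∀ {as} → (∀ {u w} → End u → End w → ¬ TransClosure (Arcs as) u w) →
    Sink (contract as) vₑ ⇔ (Sink as u₁ × Sink as u₂)
  sink-vₑ {as} separated = mk⇔
    (λ s → All.tabulate (lower (map⁻ s) (inj₁ refl)) , All.tabulate (lower (map⁻ s) (inj₂ refl)))
    (λ (s₁ , s₂) → map⁺ (All.tabulate (raise s₁ s₂)))
    where
    lower : All (λ (t , h) → π t ≡ vₑ ⊎ π h ≡ vₑ → π h ≡ vₑ) as → ∀ {u} → End u →
            ∀ {(t , h) : Carrier × Carrier} → (t , h) ∈ as → t ≡ u ⊎ h ≡ u → h ≡ u
    lower s e arc (inj₂ h≡u)  = h≡u
    lower s e arc (inj₁ refl) =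
      contradiction [ arc ] (separated e (π-end⁻ (All.lookup s arc (inj₁ (π-end e)))))

    raise : Sink as u₁ → Sink as u₂ →
            ∀ {(t , h) : Carrier × Carrier} → (t , h) ∈ as → π t ≡ vₑ ⊎ π h ≡ vₑ → π h ≡ vₑ
    raise s₁ s₂ arc (inj₂ πh≡vₑ) = πh≡vₑ
    raise s₁ s₂ arc (inj₁ πt≡vₑ) with π-end⁻ πt≡vₑ
    ... | inj₁ t≡u₁ = π-end (inj₁ (All.lookup s₁ arc (inj₁ t≡u₁)))
    ... | inj₂ t≡u₂ = π-end (inj₂ (All.lookup s₂ arc (inj₁ t≡u₂)))

-- Weights of oriented graphs

module Contributions (R : CommutativeRing 0ℓ 0ℓ) where
  open ListFolds R

  module _ (W : FiniteSet) where
    open FiniteSet W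

    private
      Arc = Carrier × Carrier

    cyclic? : (as : List Arc) → Dec (Cyclic as)
    cyclic? as = map′ Any.satisfied (λ (v , c) → lose (complete v) c)
      (any? (λ v → closure? _≟_ as v v) elements)

    acyclicArcs? : (as : List Arc) → Dec (¬ Cyclic as)
    acyclicArcs? as = ¬? (cyclic? as)

    sinkArcs? : (as : List Arc) → Decidable (Sink as)
    sinkArcs? as v = All.all? (λ (t , h) → (t ≟ v ⊎-dec h ≟ v) →-dec h ≟ v) as

    module _ (σ : Carrier → K) where

      weight : List Arc → K
      weight as = ∏ (map σ (filter (sinkArcs? as) elements))

      -- The default `𝟘` makes cyclic orientations harmless, so sums can range over all
      -- orientations; likewise the default `𝟙` in `factor` lets products range over all vertices.
      contribution : List Arc → K
      contribution as = if does (acyclicArcs? as) then weight as else 𝟘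

      factor : List Arc → Carrier → K
      factor as v = if does (sinkArcs? as v) then σ v else 𝟙

      contribution-acyclic : ∀ {as} → ¬ Cyclic as → contribution as ∼ weight as
      contribution-acyclic {as} acyclic = ∼-reflexive
        (cong (if_then weight as else 𝟘) (dec-true (acyclicArcs? as) acyclic))

      contribution-cyclic : ∀ {as} → Cyclic as → contribution as ∼ 𝟘
      contribution-cyclic {as} cyclic = ∼-reflexive
        (cong (if_then weight as else 𝟘) (dec-false (acyclicArcs? as) (λ acyclic → acyclic cyclic)))

      factor-sink : ∀ {as v} → Sink as v → factor as v ∼ σ v
      factor-sink {as} {v} sink = ∼-reflexive
        (cong (if_then σ v else 𝟙) (dec-true (sinkArcs? as v) sink))

      factor-nonsink : ∀ {as v} → ¬ Sink as v → factor as v ∼ 𝟙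
      factor-nonsink {as} {v} ¬sink = ∼-reflexive
        (cong (if_then σ v else 𝟙) (dec-false (sinkArcs? as v) ¬sink))

      weight-cong : ∀ {as bs} → (∀ {v} → Sink as v ⇔ Sink bs v) → weight as ∼ weight bs
      weight-cong {as} {bs} eq = ∼-reflexive (cong (∏ ∘ map σ)
        (filter-≐ (sinkArcs? as) (sinkArcs? bs) (Equivalence.to eq , Equivalence.from eq) elements))

      weight-factors : ∀ {vs} → elements ↭ vs → ∀ as → weight as ∼ ∏ (map (factor as) vs)
      weight-factors elements↭vs as =
        ∼-trans (∏-filter (sinkArcs? as) σ elements) (∏-↭ (factor as) elements↭vs)

      contribution-↭ : ∀ {as bs} → as ↭ bs → contribution as ∼ contribution bs
      contribution-↭ {as} {bs} as↭bs = ∼-trans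
        (∼-reflexive (cong (if_then weight as else 𝟘) (does-⇔
          (mk⇔ (_∘ cyclic-⊆ (∈-resp-↭ (↭-sym as↭bs))) (_∘ cyclic-⊆ (∈-resp-↭ as↭bs)))
          (acyclicArcs? as) (acyclicArcs? bs))))
        (if-cong (does (acyclicArcs? bs)))
        where
        if-cong : ∀ b → (if b then weight as else 𝟘) ∼ (if b then weight bs else 𝟘)
        if-cong true  = weight-cong (mk⇔ (All-resp-↭ as↭bs) (All-resp-↭ (↭-sym as↭bs)))
        if-cong false = ∼-refl

  factor-cong : ∀ {W W′ : FiniteSet} (σ : FiniteSet.Carrier W → K) (τ : FiniteSet.Carrier W′ → K)
    {as bs v w} → Sink as v ⇔ Sink bs w → σ v ∼ τ w → factor W σ as v ∼ factor W′ τ bs w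
  factor-cong {W} {W′} σ τ {as} {bs} {v} {w} eq σv∼τw with sinkArcs? W as v
  ... | yes s = ∼-trans σv∼τw (∼-sym (factor-sink W′ τ (Equivalence.to eq s)))
  ... | no ¬s = ∼-sym (factor-nonsink W′ τ (¬s ∘ Equivalence.from eq))

-- The deletion-contraction relation

module DeletionContraction
  (R : CommutativeRing 0ℓ 0ℓ) (V : FiniteSet) (u₁ u₂ : FiniteSet.Carrier V) (u₁≢u₂ : u₁ ≢ u₂) where
  open FiniteSet V
  open Contraction V u₁ u₂ u₁≢u₂
  open ListFolds R
  open Contributions R
  open Orientations R
  open SetoidReasoning setoid
  open AbelianGroupProperties +-abelianGroup using (xyx⁻¹≈y)

  private
    W : FiniteSet
    W = merged V u₁ u₂

    Arc : Set
    Arc = Carrier × Carrier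

  x+[y-x]≈y : ∀ x y → x ⊕ (y ⊕ ⊖ x) ∼ y
  x+[y-x]≈y x y = ∼-trans (∼-sym (+-assoc x y (⊖ x))) (xyx⁻¹≈y x y)

  module _ (σ : Carrier → K) (τ : Merged u₁ u₂ → K) (τ-old : ∀ v p q → τ (old v p q) ∼ σ v)
           (τ-vₑ : τ vₑ ∼ σ u₂ ⊕ σ u₁ ⊕ ⊖ (σ u₂ ⊗ σ u₁)) where
    private
      f : List Arc → Carrier → K
      f = factor V σ

      f/ : List Arc → Merged u₁ u₂ → K
      f/ as = factor W τ (contract as)

      P : List Arc → K
      P as = ∏ (map (f/ as) others)

    weight-contract : ∀ as → weight W τ (contract as) ∼ f/ as vₑ ⊗ P as
    weight-contract as = weight-factors W τ merged-elements-↭ (contract as)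

    -- Used for `as` and for its two extensions. An arc between the ends does not affect the sinks
    -- elsewhere, so all three share the cofactor `P as`, which is read off in the contraction.
    weight-split : ∀ as bs → (∀ {v} → v ≢ u₁ → v ≢ u₂ → Sink bs v ⇔ Sink as v) →
      weight V σ bs ∼ f bs u₂ ⊗ (f bs u₁ ⊗ P as)
    weight-split as bs same-sinks = ∼-trans (weight-factors V σ elements-↭ bs)
      (*-congˡ (*-congˡ (∼-trans (∼-reflexive (cong ∏ (sym (map-∘ others))))
        (∏-cong (All.map same-factor others-≢vₑ)))))
      where
      same-factor : ∀ {x} → x ≢ vₑ → f bs (representative x) ∼ f/ as x
      same-factor {vₑ}        x≢vₑ = contradiction refl x≢vₑ
      same-factor {old v p q} _    = factor-cong {V} {W} σ τ
        (mk⇔ (Equivalence.from sink-other ∘ Equivalence.to (same-sinks p q))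
             (Equivalence.from (same-sinks p q) ∘ Equivalence.to sink-other))
        (∼-sym (τ-old v p q))

    factor-vₑ : ∀ {as} → (∀ {u w} → End u → End w → ¬ TransClosure (Arcs as) u w) →
      f/ as vₑ ∼ f as u₂ ⊕ f as u₁ ⊕ ⊖ (f as u₂ ⊗ f as u₁)
    factor-vₑ {as} separated with sinkArcs? V as u₁ | sinkArcs? V as u₂
    ... | yes s₁ | yes s₂ =
      ∼-trans (factor-sink W τ (Equivalence.from (sink-vₑ separated) (s₁ , s₂))) τ-vₑ
    -- With factor `𝟙` at `u₁` and `y` at `u₂`, the right side is `y + 1 - y`, whichever value `y`
    -- has.
    ... | no ¬s₁ | d₂     =
      ∼-trans (factor-nonsink W τ (¬s₁ ∘ proj₁ ∘ Equivalence.to (sink-vₑ separated)))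
        (∼-sym (∼-trans (+-cong ∼-refl (-‿cong (*-identityʳ _)))
                        (xyx⁻¹≈y (if does d₂ then σ u₂ else 𝟙) 𝟙)))
    ... | yes _  | no ¬s₂ =
      ∼-trans (factor-nonsink W τ (¬s₂ ∘ proj₂ ∘ Equivalence.to (sink-vₑ separated)))
        (∼-sym (∼-trans (+-cong (+-comm 𝟙 (σ u₁)) (-‿cong (*-identityˡ (σ u₁))))
                        (xyx⁻¹≈y (σ u₁) 𝟙)))

    Relation : List Arc → Set
    Relation as =
      contribution V σ ((u₁ , u₂) ∷ as) ⊕ contribution V σ ((u₂ , u₁) ∷ as) ∼
      contribution V σ as ⊕ contribution W τ (contract as)

    relation-cyclic : ∀ {as} → Cyclic as → Relation as
    relation-cyclic cyclic@(_ , c) = +-cong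
      (∼-trans (contribution-cyclic V σ (cyclic-⊆ there cyclic))
               (∼-sym (contribution-cyclic V σ cyclic)))
      (∼-trans (contribution-cyclic V σ (cyclic-⊆ there cyclic))
               (∼-sym (contribution-cyclic W τ (cyclic-map π refl c))))

    -- The start of a path is not a sink, so an arc parallel to the path changes no sink.
    contribution-parallel : ∀ {as u w} → u ≢ w → ¬ Cyclic as → TransClosure (Arcs as) u w →
      contribution V σ ((u , w) ∷ as) ∼ contribution V σ as
    contribution-parallel {as} {u} {w} u≢w acyclic u⇝w = ∼-trans
      (contribution-acyclic V σ acyclic-∷)
      (∼-trans (weight-cong V σ same-sinks) (∼-sym (contribution-acyclic V σ acyclic)))
      where
      acyclic-∷ : ¬ Cyclic ((u , w) ∷ as)
      acyclic-∷ c with cyclic-∷⁻ c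
      ... | inj₁ c′         = acyclic c′
      ... | inj₂ (inj₁ w≡u) = u≢w (sym w≡u)
      ... | inj₂ (inj₂ w⇝u) = acyclic (u , u⇝w TC.++ w⇝u)

      same-sinks : ∀ {v} → Sink ((u , w) ∷ as) v ⇔ Sink as v
      same-sinks {v} with u ≟ v
      ... | yes refl = mk⇔ (λ s → contradiction s (tail-not-sink {as = as} u≢w))
                           (λ s → contradiction s (source-not-sink acyclic u⇝w))
      ... | no u≢v   = sink-∷ u≢v

    relation-path₁₂ : ∀ {as} → ¬ Cyclic as → TransClosure (Arcs as) u₁ u₂ → Relation as
    relation-path₁₂ acyclic u₁⇝u₂ = +-cong
      (contribution-parallel u₁≢u₂ acyclic u₁⇝u₂)
      (∼-trans (contribution-cyclic V σ (cyclic-closing u₁⇝u₂))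
               (∼-sym (contribution-cyclic W τ (cyclic-map π u₁~u₂ u₁⇝u₂))))
      where
      u₁~u₂ : π u₁ ≡ π u₂
      u₁~u₂ = trans (π-end (inj₁ refl)) (sym (π-end (inj₂ refl)))

    relation-path₂₁ : ∀ {as} → ¬ Cyclic as → TransClosure (Arcs as) u₂ u₁ → Relation as
    relation-path₂₁ acyclic u₂⇝u₁ = ∼-trans (+-comm _ _) (+-cong
      (contribution-parallel (u₁≢u₂ ∘ sym) acyclic u₂⇝u₁)
      (∼-trans (contribution-cyclic V σ (cyclic-closing u₂⇝u₁))
               (∼-sym (contribution-cyclic W τ (cyclic-map π u₂~u₁ u₂⇝u₁)))))
      where
      u₂~u₁ : π u₂ ≡ π u₁
      u₂~u₁ = trans (π-end (inj₂ refl)) (sym (π-end (inj₁ refl)))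

    relation-separated : ∀ {as} → ¬ Cyclic as → ¬ TransClosure (Arcs as) u₁ u₂ →
      ¬ TransClosure (Arcs as) u₂ u₁ → Relation as
    relation-separated {as} acyclic u₁↛u₂ u₂↛u₁ = begin
      contribution V σ ((u₁ , u₂) ∷ as) ⊕ contribution V σ ((u₂ , u₁) ∷ as)
        ≈⟨ +-cong (contribution-acyclic V σ acyclic₁₂) (contribution-acyclic V σ acyclic₂₁) ⟩
      weight V σ ((u₁ , u₂) ∷ as) ⊕ weight V σ ((u₂ , u₁) ∷ as)
        ≈⟨ +-cong (weight-split as _ (λ v≢u₁ _ → sink-∷ (v≢u₁ ∘ sym)))
                  (weight-split as _ (λ _ v≢u₂ → sink-∷ (v≢u₂ ∘ sym))) ⟩
      f ((u₁ , u₂) ∷ as) u₂ ⊗ (f ((u₁ , u₂) ∷ as) u₁ ⊗ p) ⊕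
      f ((u₂ , u₁) ∷ as) u₂ ⊗ (f ((u₂ , u₁) ∷ as) u₁ ⊗ p)
        -- In either extension the head keeps the factor it has in `as`, and the tail contributes
        -- `𝟙`.
        ≈⟨ +-cong
             (*-cong (factor-cong {V} {V} σ σ (sink-∷ {as = as} u₁≢u₂) ∼-refl)
                     (*-congʳ (factor-nonsink V σ (tail-not-sink {as = as} u₁≢u₂))))
             (*-cong (factor-nonsink V σ (tail-not-sink {as = as} u₂≢u₁))
                     (*-congʳ (factor-cong {V} {V} σ σ (sink-∷ {as = as} u₂≢u₁) ∼-refl))) ⟩
      y ⊗ (𝟙 ⊗ p) ⊕ 𝟙 ⊗ (x ⊗ p)
        ≈⟨ +-cong (*-congˡ (*-identityˡ p)) (*-identityˡ (x ⊗ p)) ⟩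
      y ⊗ p ⊕ x ⊗ p
        ≈⟨ distribʳ p y x ⟨
      (y ⊕ x) ⊗ p
        -- Add and subtract `y ⊗ x`: the first summand becomes the weight of `as`, the rest that of
        -- its contraction.
        ≈⟨ *-congʳ (x+[y-x]≈y (y ⊗ x) (y ⊕ x)) ⟨
      (y ⊗ x ⊕ (y ⊕ x ⊕ ⊖ (y ⊗ x))) ⊗ p
        ≈⟨ distribʳ p (y ⊗ x) _ ⟩
      y ⊗ x ⊗ p ⊕ (y ⊕ x ⊕ ⊖ (y ⊗ x)) ⊗ p
        ≈⟨ +-cong (*-assoc y x p) (*-congʳ (∼-sym (factor-vₑ separated))) ⟩
      y ⊗ (x ⊗ p) ⊕ f/ as vₑ ⊗ p
        ≈⟨ +-cong (weight-split as as (λ _ _ → mk⇔ (λ s → s) (λ s → s))) (weight-contract as) ⟨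
      weight V σ as ⊕ weight W τ (contract as)
        ≈⟨ +-cong (contribution-acyclic V σ acyclic)
             (contribution-acyclic W τ
               (acyclic-map π End fibre separated
                 (λ x → representative x , π-representative x) acyclic)) ⟨
      contribution V σ as ⊕ contribution W τ (contract as) ∎
      where
      x = f as u₁
      y = f as u₂
      p = P as

      u₂≢u₁ : u₂ ≢ u₁
      u₂≢u₁ = u₁≢u₂ ∘ sym

      separated : ∀ {u w} → End u → End w → ¬ TransClosure (Arcs as) u w
      separated (inj₁ refl) (inj₁ refl) c = acyclic (_ , c)
      separated (inj₁ refl) (inj₂ refl) c = u₁↛u₂ c
      separated (inj₂ refl) (inj₁ refl) c = u₂↛u₁ c
      separated (inj₂ refl) (inj₂ refl) c = acyclic (_ , c)

      acyclic₁₂ : ¬ Cyclic ((u₁ , u₂) ∷ as)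
      acyclic₁₂ = [ acyclic , [ u₂≢u₁ , u₂↛u₁ ]′ ]′ ∘ cyclic-∷⁻

      acyclic₂₁ : ¬ Cyclic ((u₂ , u₁) ∷ as)
      acyclic₂₁ = [ acyclic , [ u₁≢u₂ , u₁↛u₂ ]′ ]′ ∘ cyclic-∷⁻

    relation : ∀ as → Relation as
    relation as with acyclicArcs? V as | closure? _≟_ as u₁ u₂ | closure? _≟_ as u₂ u₁
    ... | yes acyclic | yes u₁⇝u₂ | _         = relation-path₁₂ acyclic u₁⇝u₂
    ... | yes acyclic | no _      | yes u₂⇝u₁ = relation-path₂₁ acyclic u₂⇝u₁
    ... | yes acyclic | no u₁↛u₂  | no u₂↛u₁  = relation-separated acyclic u₁↛u₂ u₂↛u₁
    ... | no ¬acyclic | _         | _         =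
      relation-cyclic (decidable-stable (cyclic? V as) ¬acyclic)

    -- Once e stands in front, its two directions give the two extensions of each orientation of the
    -- other edges, and `relation` is summed over these. The ends enter through an equation because
    -- `u₁` and `u₂` are fixed before `es`.
    ∑-deletion-contraction : ∀ es (e : Fin (length es)) → lookup es e ≡ (u₁ , u₂) →
      ∑-orientations (contribution V σ) es ∼
      ∑-orientations (contribution V σ) (removeAt es e) ⊕
      ∑-orientations (contribution W τ) (contract (removeAt es e))
    ∑-deletion-contraction es e eq = begin
      ∑-orientations F es
        ≈⟨ ∑-orientations-removeAt F (contribution-↭ V σ) es e ⟩
      ∑-orientations F (lookup es e ∷ es′)
        ≈⟨ ∼-reflexive (cong (λ a → ∑-orientations F (a ∷ es′)) eq) ⟩
      ∑-orientations F₁₂ es′ ⊕ ∑-orientations F₂₁ es′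
        ≈⟨ ∑-orientations-⊕ F₁₂ F₂₁ es′ ⟨
      ∑-orientations (λ as → F₁₂ as ⊕ F₂₁ as) es′
        ≈⟨ ∑-orientations-cong relation es′ ⟩
      ∑-orientations (λ as → F as ⊕ F/ (contract as)) es′
        ≈⟨ ∑-orientations-⊕ F (F/ ∘ contract) es′ ⟩
      ∑-orientations F es′ ⊕ ∑-orientations (F/ ∘ contract) es′
        ≈⟨ +-cong ∼-refl (∑-orientations-map π F/ es′) ⟨
      ∑-orientations F es′ ⊕ ∑-orientations F/ (contract es′) ∎
      where
      es′ = removeAt es e
      F   = contribution V σ
      F/  = contribution W τ
      F₁₂ = F ∘ ((u₁ , u₂) ∷_)
      F₂₁ = F ∘ ((u₂ , u₁) ∷_)

-- The acyclic orientation polynomial as a sum of contributions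

module _ (G : Graph) where
  open Graph G
  open FiniteSet vertices using (elements)

  module _ (R : CommutativeRing 0ℓ 0ℓ) where
    open ListFolds R
    open Contributions R
    open Orientations R
    open SetoidReasoning setoid

    -- The values `σ` are left general so that this covers both `A`, where they are variables, and
    -- the image of `A` under a substitution.
    ∑-acyclic : (σ : Vertex → K) →
      ∑ (map (λ o → ∏ (map σ (filter (isSink? G o) elements)))
             (filter (acyclic? G) (allDirections (length edges)))) ∼
      ∑-orientations (contribution vertices σ) edges
    ∑-acyclic σ = begin
      ∑ (map w (filter (acyclic? G) os))
        ≈⟨ ∑-filter (acyclic? G) w os ⟩
      ∑ (map (λ o → if does (acyclic? G o) then w o else 𝟘) os)
        ≈⟨ ∑-cong (All.universal
             (λ o → ∼-reflexive (cong (if_then w o else 𝟘) (same-decision o))) os) ⟩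
      ∑ (map (λ o → contribution vertices σ (arcs G o)) os)
        ≈⟨ ∑-directions (contribution vertices σ) edges ⟩
      ∑-orientations (contribution vertices σ) edges ∎
      where
      os = allDirections (length edges)

      w : Orientation G → K
      w o = ∏ (map σ (filter (isSink? G o) elements))

      -- One test speaks of cycles through distinct vertices, the other of closed walks. The two
      -- sink tests, by contrast, agree by computation.
      same-decision : ∀ o → does (acyclic? G o) ≡ does (acyclicArcs? vertices (arcs G o))
      same-decision o =
        does-⇔ (mk⇔ (_∘ from) (_∘ to)) (acyclic? G o) (acyclicArcs? vertices (arcs G o))
        where open Equivalence (cycle⇔closure (FiniteSet._≟_ vertices) {Arcs (arcs G o)})

open Graph

theorem2p3 : (G : Graph) (e : Edge G) → NonLoop G e →
    (A G ≈ A (G ∖ e) + substitute (uncontract G e) (A (G / e)))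
    × (uncontract G e vₑ ≈
    var (end₁ G e) + var (end₂ G e) - var (end₁ G e) * var (end₂ G e))
theorem2p3 G e u₁≢u₂ = ≃⇒≈ deletion-contraction , ≃⇒≈ uncontract-vₑ
  where
  open PolynomialRing (vertices G)
  open ListFolds commutativeRing
  open Contributions commutativeRing
  open Orientations commutativeRing
  open SetoidReasoning setoid
  open Solver using (solve; con; _:+_; _:-_; _:*_; _:=_)

  u₁ = end₁ G e
  u₂ = end₂ G e
  x = var {vertices G} u₁
  y = var {vertices G} u₂
  τ = uncontract G e

  uncontract-vₑ : τ vₑ ≃ x + y - x * y
  uncontract-vₑ = solve 2 (λ x y → con 1ℤ :- (con 1ℤ :- x) :* (con 1ℤ :- y) := x :+ y :- x :* y)
    ∼-refl x y

  -- A ring homomorphism passes through the sum and the products down to the variables, leaving the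
  -- same expression with the values `τ`.
  substitute-A : substitute τ (A (G / e)) ≃
    ∑-orientations (contribution (vertices (G / e)) τ) (edges (G / e))
  substitute-A = ∼-trans
    (substitute-sum (product ∘ map var ∘ sinks) (product ∘ map τ ∘ sinks)
      (substitute-product ∘ sinks)
      (filter (acyclic? (G / e)) (allDirections (length (edges (G / e))))))
    (∑-acyclic (G / e) commutativeRing τ)
    where
    open Substitution {vertices (G / e)} τ
    sinks = λ o → filter (isSink? (G / e) o) (FiniteSet.elements (vertices (G / e)))

  open DeletionContraction commutativeRing (vertices G) u₁ u₂ u₁≢u₂

  -- The end `u₂` comes first here, in accordance with the order of the ends in `elements-↭`.
  τ-vₑ : τ vₑ ≃ y + x - y * x
  τ-vₑ = solve 2 (λ x y → con 1ℤ :- (con 1ℤ :- x) :* (con 1ℤ :- y) := y :+ x :- y :* x) ∼-refl x y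

  deletion-contraction : A G ≃ A (G ∖ e) + substitute τ (A (G / e))
  deletion-contraction = begin
    A G
      ≈⟨ ∑-acyclic G commutativeRing var ⟩
    ∑-orientations (contribution (vertices G) var) (edges G)
      ≈⟨ ∑-deletion-contraction var τ (λ v _ _ → ∼-refl {var v}) τ-vₑ (edges G) e refl ⟩
    ∑-orientations (contribution (vertices G) var) (edges (G ∖ e)) +
    ∑-orientations (contribution (vertices (G / e)) τ) (edges (G / e))
      ≈⟨ +-cong (∑-acyclic (G ∖ e) commutativeRing var) substitute-A ⟨
    A (G ∖ e) + substitute τ (A (G / e)) ∎
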